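{- Let $D=(X,Y,A)$ be an oriented split graph in which $D[Y]$ is an almost regular tournament with $2d$ vertices. Then $D$ has a Sullivan vertex, i.e. a vertex $u$ with $|N^{++}(u)|\ge |N^-(u)|$.
   Context: An oriented split graph $D=(X,Y,A)$ is an oriented graph (loopless, no pair of opposite arcs) whose vertex set is partitioned into $X$ and $Y$ with $X$ independent and $D[Y]$ a tournament. A tournament is almost regular if $|d^+(x)-d^-(x)|=1$ for each vertex $x$. $N^-(u)=\{v:vu\in A\}$, $N^+(u)=\{v:uv\in A\}$, $N^{++}(u)=\{v: uw,wv\in A\text{ for some } w\}\setminus N^+(u)$, all in $D$. -}

module Defs where

open import Data.Nat using (ℕ; suc)
open import Data.Fin using (Fin)
open import Data.Bool using (Bool; true; false; _∧_; not)
open import Data.List using (List; filter; length)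
open import Data.Bool.ListAction using (any)
open import Data.List using () renaming (allFin to allFinL)
open import Data.Product using (_×_; Σ; ∃)
open import Data.Sum using (_⊎_)
open import Data.Empty using (⊥)
open import Relation.Binary.PropositionalEquality using (_≡_)
open import Relation.Nullary using (¬_)
open import Relation.Nullary.Decidable using (Dec)
open import Data.Bool using (T)
open import Data.Bool.Properties using (T?)

-- A digraph on vertex set Fin n, given by a Boolean arc relation:
-- arc u v ≡ true  means  uv ∈ A.
Digraph : ℕ → Set
Digraph n = Fin n → Fin n → Bool

IsOriented : {n : ℕ} → Digraph n → Set
IsOriented {n} arc =
  ((u : Fin n) → arc u u ≡ false) ×
  ((u v : Fin n) → arc u v ≡ true → arc v u ≡ false)

-- Oriented split graph with Y = {v | inY v ≡ true}, X = complement.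
-- X is independent and D[Y] is a tournament.
IsOrientedSplit : {n : ℕ} → Digraph n → (Fin n → Bool) → Set
IsOrientedSplit {n} arc inY =
  IsOriented arc ×
  ((u v : Fin n) → inY u ≡ false → inY v ≡ false → arc u v ≡ false) ×
  ((u v : Fin n) → inY u ≡ true → inY v ≡ true → ¬ (u ≡ v) →
     (arc u v ≡ true) ⊎ (arc v u ≡ true))

count : {n : ℕ} → (Fin n → Bool) → ℕ
count {n} p = length (filter (λ v → T? (p v)) (allFinL n))

inNbr : {n : ℕ} → Digraph n → Fin n → Fin n → Bool
inNbr arc u v = arc v u

outNbr : {n : ℕ} → Digraph n → Fin n → Fin n → Bool
outNbr arc u v = arc u v

secondOutNbr : {n : ℕ} → Digraph n → Fin n → Fin n → Bool
secondOutNbr {n} arc u v =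
  any (λ w → arc u w ∧ arc w v) (allFinL n) ∧ not (arc u v)

outDegIn : {n : ℕ} → Digraph n → (Fin n → Bool) → Fin n → ℕ
outDegIn arc inY y = count (λ v → inY v ∧ arc y v)

inDegIn : {n : ℕ} → Digraph n → (Fin n → Bool) → Fin n → ℕ
inDegIn arc inY y = count (λ v → inY v ∧ arc v y)

IsAlmostRegularOn : {n : ℕ} → Digraph n → (Fin n → Bool) → Set
IsAlmostRegularOn {n} arc inY =
  (y : Fin n) → inY y ≡ true →
    (outDegIn arc inY y ≡ suc (inDegIn arc inY y)) ⊎
    (inDegIn arc inY y ≡ suc (outDegIn arc inY y))

IsSullivan : {n : ℕ} → Digraph n → Fin n → Set
IsSullivan arc u = count (inNbr arc u) Data.Nat.≤ count (secondOutNbr arc u)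

{-# OPTIONS --safe #-}
module Submission where

-- Suppose no vertex is Sullivan, and for x ∈ X let A, B, C be N⁻(x), N⁺(x) and the rest of Y. Let Z
-- be the set of vertices of Y ∖ B dominating B, and W that of vertices of Y ∖ A dominated by A.
-- Since x is not Sullivan, |Z| > |C| + |N⁺⁺(x) ∩ X|. All degrees in D[Y] are at most d, so counting
-- the arcs leaving Z and those entering W gives 2|B| + |Z| ≤ 2d + 1 and 2|A| + |W| ≤ 2d + 1, hence
-- |Z| + |W| ≤ 2|C| + 2. Call x tight if |W| > |C|; then |Z| = |W| = |C| + 1, N⁺⁺(x) ∩ X = ∅, and
-- both counts are equalities.
--
-- A vertex y ∈ Y of out-degree d in D[Y] reaches all its in-neighbours in Y by 2-paths, and a vertex
-- of out-degree d - 1 all but at most one. Summing the failure of the Sullivan inequality over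
-- all y ∈ Y yields at least d tight vertices.
--
-- Take t tight with |C| minimal and z ∈ Z ∩ A. Minimality forces z to dominate every tight vertex.
-- As z has out-degree d in D[Y] and is not Sullivan, it has an in-neighbour x ∈ X, and then N⁺⁺(x)
-- contains all tight vertices, so |Z| > d for x; but Z ⊆ N⁻(z), whose part in Y has at most d vertices.

open import Defs
open import Data.Nat hiding (_≟_)
open import Data.Nat.Properties hiding (_≟_)
open import Data.Nat.Tactic.RingSolver using (solve-∀)
open import Data.Fin using (Fin; zero; suc)
open import Data.Fin.Properties using (_≟_; any?)
open import Data.Bool using (Bool; true; false; _∧_; _∨_; not)
open import Data.Bool.Properties using (T?; T-≡; ∧-zeroʳ; ∨-identityʳ; ¬-not)
open import Data.List using (filter; length; tabulate; allFin)
open import Data.List.Membership.Propositional.Properties using (∈-allFin)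
open import Data.List.Membership.Propositional using (lose)
open import Data.List.Relation.Unary.Any.Properties using (any⁺)
open import Data.Bool.ListAction using (any)
open import Data.Product using (∃; _×_; _,_; proj₁; proj₂)
open import Data.Sum using (_⊎_; inj₁; inj₂; swap)
open import Data.Empty using (⊥; ⊥-elim)
open import Function using (_∘_; id; flip; Equivalence)
open import Relation.Nullary.Decidable using (dec-true; dec-false)
open import Relation.Nullary using (¬_; does; yes; no; contradiction)
open import Relation.Binary.PropositionalEquality
open import Algebra.Properties.Semiring.Sum +-*-semiring
  using (sum; sum-cong-≗; sum-replicate-zero; ∑-distrib-+; ∑-comm; *-distribʳ-sum; *-distribˡ-sum)

private
  variable
    n : ℕ
    a b : Bool

-- Boolean indicators and counting over `Fin n`.

∧-true : a ∧ b ≡ true → a ≡ true × b ≡ true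
∧-true {true} {true} _ = refl , refl

∧-intro : a ≡ true → b ≡ true → a ∧ b ≡ true
∧-intro refl refl = refl

not-true : not a ≡ true → a ≡ false
not-true {false} _ = refl

true≢false : a ≡ true → a ≡ false → ⊥
true≢false refl ()

⟦_⟧ : Bool → ℕ
⟦ true ⟧ = 1
⟦ false ⟧ = 0

⟦⟧-mono : (a ≡ true → b ≡ true) → ⟦ a ⟧ ≤ ⟦ b ⟧
⟦⟧-mono {false} f = z≤n
⟦⟧-mono {true} {b} f rewrite f refl = ≤-refl

# : (Fin n → Bool) → ℕ
# p = sum (λ v → ⟦ p v ⟧)

count≡# : (p : Fin n → Bool) → count p ≡ # p
count≡# p = go p id
  where
  go : ∀ {m} {k} (p : Fin k → Bool) (f : Fin m → Fin k) →
       length (filter (λ v → T? (p v)) (tabulate f)) ≡ # (p ∘ f)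
  go {zero} p f = refl
  go {suc m} p f with p (f zero)
  ... | true = cong suc (go p (f ∘ suc))
  ... | false = go p (f ∘ suc)

sum-mono : {f g : Fin n → ℕ} → (∀ i → f i ≤ g i) → sum f ≤ sum g
sum-mono {zero} f≤g = z≤n
sum-mono {suc n} f≤g = +-mono-≤ (f≤g zero) (sum-mono (f≤g ∘ suc))

term≤sum : (f : Fin n → ℕ) (i : Fin n) → f i ≤ sum f
term≤sum f zero = m≤m+n _ _
term≤sum f (suc i) = ≤-trans (term≤sum (f ∘ suc) i) (m≤n+m _ _)

#-mono : {p q : Fin n → Bool} → (∀ v → p v ≡ true → q v ≡ true) → # p ≤ # q
#-mono p⊆q = sum-mono (λ v → ⟦⟧-mono (p⊆q v))

#-inhabited : (p : Fin n → Bool) {v : Fin n} → p v ≡ true → 1 ≤ # p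
#-inhabited p {v} pv = subst (λ b → ⟦ b ⟧ ≤ # p) pv (term≤sum (λ v → ⟦ p v ⟧) v)

#<#⇒∃ : (p q : Fin n → Bool) → # q < # p → ∃ λ v → p v ≡ true × q v ≡ false
#<#⇒∃ {suc n} p q lt with p zero in eqp | q zero in eqq
... | true | false = zero , eqp , eqq
... | true | true = let v , r = #<#⇒∃ (p ∘ suc) (q ∘ suc) (s<s⁻¹ lt) in suc v , r
... | false | false = let v , r = #<#⇒∃ (p ∘ suc) (q ∘ suc) lt in suc v , r
... | false | true = let v , r = #<#⇒∃ (p ∘ suc) (q ∘ suc) (<-trans (n<1+n _) lt) in suc v , r

#-positive : (p : Fin n → Bool) → 1 ≤ # p → ∃ λ v → p v ≡ true
#-positive {n} p 1≤p =
  let v , pv , _ = #<#⇒∃ p (λ _ → false) (subst (_< # p) (sym (sum-replicate-zero n)) 1≤p)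
  in v , pv

#-singleton : (i : Fin n) → # (λ j → does (i ≟ j)) ≡ 1
#-singleton {suc n} zero = cong suc (sum-replicate-zero n)
#-singleton (suc i) = #-singleton i

sum-split : {f g h : Fin n → ℕ} → (∀ i → f i ≡ g i + h i) → sum f ≡ sum g + sum h
sum-split {g = g} {h} f≗g+h = trans (sum-cong-≗ f≗g+h) (∑-distrib-+ g h)

sum-split₃ : {f g h k : Fin n → ℕ} → (∀ i → f i ≡ g i + (h i + k i)) → sum f ≡ sum g + (sum h + sum k)
sum-split₃ {g = g} {h} {k} f≗ =
  trans (sum-split {g = g} {λ i → h i + k i} f≗) (cong (sum g +_) (∑-distrib-+ h k))

-- Both sides count the pairs with `p u`, `q v` and `R v u`, grouped by one coordinate or the other.
double-count : (p q : Fin n → Bool) (R : Fin n → Fin n → Bool) →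
  sum (λ u → ⟦ p u ⟧ * # (λ v → q v ∧ R v u)) ≡ sum (λ v → ⟦ q v ⟧ * # (λ u → p u ∧ R v u))
double-count p q R = begin
  sum (λ u → ⟦ p u ⟧ * # (λ v → q v ∧ R v u))
    ≡⟨ sum-cong-≗ (λ u → *-distribˡ-sum ⟦ p u ⟧ (λ v → ⟦ q v ∧ R v u ⟧)) ⟩
  sum (λ u → sum (λ v → ⟦ p u ⟧ * ⟦ q v ∧ R v u ⟧))
    ≡⟨ ∑-comm (λ u v → ⟦ p u ⟧ * ⟦ q v ∧ R v u ⟧) ⟩
  sum (λ v → sum (λ u → ⟦ p u ⟧ * ⟦ q v ∧ R v u ⟧))
    ≡⟨ sum-cong-≗ (λ v → sum-cong-≗ (λ u → ∧-swap (p u) (q v) (R v u))) ⟩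
  sum (λ v → sum (λ u → ⟦ q v ⟧ * ⟦ p u ∧ R v u ⟧))
    ≡⟨ sum-cong-≗ (λ v → sym (*-distribˡ-sum ⟦ q v ⟧ (λ u → ⟦ p u ∧ R v u ⟧))) ⟩
  sum (λ v → ⟦ q v ⟧ * # (λ u → p u ∧ R v u)) ∎
  where
  open ≡-Reasoning
  ∧-swap : ∀ a b r → ⟦ a ⟧ * ⟦ b ∧ r ⟧ ≡ ⟦ b ⟧ * ⟦ a ∧ r ⟧
  ∧-swap false false r = refl
  ∧-swap false true r = refl
  ∧-swap true false r = refl
  ∧-swap true true r = refl

-- Degree counts in a tournament.

module Tournament (arc : Digraph n) (inY : Fin n → Bool)
  (irrefl : ∀ u → arc u u ≡ false)
  (asym : ∀ u v → arc u v ≡ true → arc v u ≡ false)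
  (semicomplete : ∀ u v → inY u ≡ true → inY v ≡ true → ¬ u ≡ v → arc u v ≡ true ⊎ arc v u ≡ true)
  where

  out in′ : Fin n → ℕ
  out y = # (λ v → inY v ∧ arc y v)
  in′ y = # (λ v → inY v ∧ arc v y)

  -- Written as indicators adding up to 1, so that summing over `v` gives a degree count.
  trichotomy : ∀ u v → inY u ≡ true → inY v ≡ true →
    1 ≡ ⟦ arc u v ⟧ + (⟦ arc v u ⟧ + ⟦ does (u ≟ v) ⟧)
  trichotomy u v yu yv with u ≟ v
  ... | yes refl rewrite irrefl u = refl
  ... | no u≢v with semicomplete u v yu yv u≢v
  ...   | inj₁ uv rewrite uv | asym u v uv = refl
  ...   | inj₂ vu rewrite vu | asym v u vu = refl

  degrees-within : (Z : Fin n → Bool) → (∀ z → Z z ≡ true → inY z ≡ true) → ∀ u → Z u ≡ true →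
    # Z ≡ # (λ v → Z v ∧ arc u v) + (# (λ v → Z v ∧ arc v u) + 1)
  degrees-within Z Z⊆Y u Zu =
    trans (sum-split₃ pointwise) (cong (λ k → # (λ v → Z v ∧ arc u v) + (# (λ v → Z v ∧ arc v u) + k))
      (#-singleton u))
    where
    pointwise : ∀ v → ⟦ Z v ⟧ ≡ ⟦ Z v ∧ arc u v ⟧ + (⟦ Z v ∧ arc v u ⟧ + ⟦ does (u ≟ v) ⟧)
    pointwise v with Z v in Zv
    ... | true = trichotomy u v (Z⊆Y u Zu) (Z⊆Y v Zv)
    ... | false with u ≟ v
    ...   | yes refl = ⊥-elim (true≢false Zu Zv)
    ...   | no _ = refl

  degree-sum : ∀ y → inY y ≡ true → # inY ≡ out y + (in′ y + 1)
  degree-sum = degrees-within inY (λ _ → id)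

  arcs-within : (Fin n → Bool) → ℕ
  arcs-within Z = sum (λ u → ⟦ Z u ⟧ * # (λ v → Z v ∧ arc u v))

  arcs-within-flip : (Z : Fin n → Bool) →
    sum (λ u → ⟦ Z u ⟧ * # (λ v → Z v ∧ arc v u)) ≡ arcs-within Z
  arcs-within-flip Z = double-count Z Z arc

  -- `degrees-within` summed over `Z`: the out-degrees inside `Z` and the in-degrees inside `Z` both
  -- add up to the number of arcs inside `Z`.
  handshake : (Z : Fin n → Bool) → (∀ z → Z z ≡ true → inY z ≡ true) →
    # Z * # Z ≡ arcs-within Z + (arcs-within Z + # Z)
  handshake Z Z⊆Y = begin
    # Z * # Z ≡⟨ *-distribʳ-sum (# Z) (λ u → ⟦ Z u ⟧) ⟩
    sum (λ u → ⟦ Z u ⟧ * # Z) ≡⟨ sum-split₃ pointwise ⟩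
    arcs-within Z + (sum (λ u → ⟦ Z u ⟧ * # (λ v → Z v ∧ arc v u)) + # Z)
      ≡⟨ cong (λ k → arcs-within Z + (k + # Z)) (arcs-within-flip Z) ⟩
    arcs-within Z + (arcs-within Z + # Z) ∎
    where
    open ≡-Reasoning
    pointwise : ∀ u → ⟦ Z u ⟧ * # Z ≡
      ⟦ Z u ⟧ * # (λ v → Z v ∧ arc u v) + (⟦ Z u ⟧ * # (λ v → Z v ∧ arc v u) + ⟦ Z u ⟧)
    pointwise u with Z u in Zu
    ... | false = refl
    ... | true = trans (cong (1 *_) (degrees-within Z Z⊆Y u Zu))
                       (distribute (# (λ v → Z v ∧ arc u v)) (# (λ v → Z v ∧ arc v u)))
      where
      distribute : ∀ i j → 1 * (i + (j + 1)) ≡ 1 * i + (1 * j + 1)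
      distribute = solve-∀

  -- Counting the arcs leaving Z: each z ∈ Z has out-degree at most d, sends arcs to all of B, and
  -- on average to half of Z.
  module Domination (d : ℕ) (out≤d : ∀ y → inY y ≡ true → out y ≤ d)
    (Z B : Fin n → Bool)
    (Z⊆Y : ∀ z → Z z ≡ true → inY z ≡ true)
    (B⊆Y : ∀ b → B b ≡ true → inY b ≡ true)
    (Z⇒B : ∀ z b → Z z ≡ true → B b ≡ true → arc z b ≡ true)
    where

    elsewhere : Fin n → ℕ
    elsewhere z = # (λ v → inY v ∧ (arc z v ∧ (not (B v) ∧ not (Z v))))

    -- What `z` loses in the two estimates behind `bound`: out-neighbours outside `B` and `Z`, and
    -- out-degree short of `d`.
    slack : Fin n → ℕ
    slack z = elsewhere z + (d ∸ out z)

    total-slack : ℕ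
    total-slack = sum (λ z → ⟦ Z z ⟧ * slack z)

    out-split : ∀ z → Z z ≡ true → out z ≡ # B + (# (λ v → Z v ∧ arc z v) + elsewhere z)
    out-split z Zz = sum-split₃ (λ v →
      cases (inY v) (B v) (Z v) (arc z v) (B⊆Y v) (Z⊆Y v) (Z⇒B z v Zz)
            -- `B` and `Z` are disjoint, since a common vertex would dominate itself.
            (λ Bv Zv → true≢false (Z⇒B v v Zv Bv) (irrefl v)))
      where
      cases : ∀ y b z a → (b ≡ true → y ≡ true) → (z ≡ true → y ≡ true) → (b ≡ true → a ≡ true) →
        (b ≡ true → z ≡ true → ⊥) →
        ⟦ y ∧ a ⟧ ≡ ⟦ b ⟧ + (⟦ z ∧ a ⟧ + ⟦ y ∧ (a ∧ (not b ∧ not z)) ⟧)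
      cases y true true a _ _ _ ¬bz = ⊥-elim (¬bz refl refl)
      cases y true false a by _ ba _ rewrite by refl | ba refl = refl
      cases y false true a _ zy _ _ rewrite zy refl with a
      ... | true = refl
      ... | false = refl
      cases true false false true _ _ _ _ = refl
      cases true false false false _ _ _ _ = refl
      cases false false false a _ _ _ _ = refl

    degree-split : ∀ z → Z z ≡ true → d ≡ # B + (# (λ v → Z v ∧ arc z v) + slack z)
    degree-split z Zz = begin
      d ≡⟨ sym (m+[n∸m]≡n (out≤d z (Z⊆Y z Zz))) ⟩
      out z + (d ∸ out z) ≡⟨ cong (_+ (d ∸ out z)) (out-split z Zz) ⟩
      # B + (h + elsewhere z) + (d ∸ out z) ≡⟨ reassoc (# B) h (elsewhere z) (d ∸ out z) ⟩
      # B + (h + slack z) ∎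
      where
      open ≡-Reasoning
      h = # (λ v → Z v ∧ arc z v)
      reassoc : ∀ i j k l → i + (j + k) + l ≡ i + (j + (k + l))
      reassoc = solve-∀

    out-arcs : # Z * d ≡ # Z * # B + (arcs-within Z + total-slack)
    out-arcs = begin
      # Z * d ≡⟨ *-distribʳ-sum d (λ u → ⟦ Z u ⟧) ⟩
      sum (λ z → ⟦ Z z ⟧ * d) ≡⟨ sum-split₃ pointwise ⟩
      sum (λ z → ⟦ Z z ⟧ * # B) + (arcs-within Z + total-slack)
        ≡⟨ cong (_+ (arcs-within Z + total-slack)) (sym (*-distribʳ-sum (# B) (λ u → ⟦ Z u ⟧))) ⟩
      # Z * # B + (arcs-within Z + total-slack) ∎
      where
      open ≡-Reasoning
      distribute : ∀ i j k → 1 * (i + (j + k)) ≡ 1 * i + (1 * j + 1 * k)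
      distribute = solve-∀
      pointwise : ∀ z → ⟦ Z z ⟧ * d ≡
        ⟦ Z z ⟧ * # B + (⟦ Z z ⟧ * # (λ v → Z v ∧ arc z v) + ⟦ Z z ⟧ * slack z)
      pointwise z with Z z in Zz
      ... | false = refl
      ... | true = trans (cong (1 *_) (degree-split z Zz)) (distribute (# B) (# (λ v → Z v ∧ arc z v)) (slack z))

    -- `degree-split` summed over `Z`, with the arcs inside `Z` eliminated by `handshake`. Keeping
    -- the slack as an exact term yields both the bound and its equality case.
    identity : # Z * (2 * # B + # Z) + 2 * total-slack ≡ # Z * (2 * d + 1)
    identity = begin
      # Z * (2 * # B + # Z) + 2 * total-slack
        ≡⟨ expand (# Z) (# B) total-slack ⟩
      2 * (# Z * # B) + # Z * # Z + 2 * total-slack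
        ≡⟨ cong (λ k → 2 * (# Z * # B) + k + 2 * total-slack) (handshake Z Z⊆Y) ⟩
      2 * (# Z * # B) + (arcs-within Z + (arcs-within Z + # Z)) + 2 * total-slack
        ≡⟨ regroup (# Z * # B) (arcs-within Z) (# Z) total-slack ⟩
      2 * (# Z * # B + (arcs-within Z + total-slack)) + # Z
        ≡⟨ cong (λ k → 2 * k + # Z) (sym out-arcs) ⟩
      2 * (# Z * d) + # Z
        ≡⟨ collect (# Z) d ⟩
      # Z * (2 * d + 1) ∎
      where
      open ≡-Reasoning
      expand : ∀ z b s → z * (2 * b + z) + 2 * s ≡ 2 * (z * b) + z * z + 2 * s
      expand = solve-∀
      regroup : ∀ p h z s → 2 * p + (h + (h + z)) + 2 * s ≡ 2 * (p + (h + s)) + z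
      regroup = solve-∀
      collect : ∀ z d → 2 * (z * d) + z ≡ z * (2 * d + 1)
      collect = solve-∀

    bound : 1 ≤ # Z → 2 * # B + # Z ≤ 2 * d + 1
    bound 1≤Z = *-cancelˡ-≤ (# Z) {{>-nonZero 1≤Z}}
      (≤-trans (m≤m+n _ (2 * total-slack)) (≤-reflexive identity))

    module Extremal (extremal : 2 * # B + # Z ≡ 2 * d + 1) where

      -- Equality leaves nothing for the slack, so each `z` in `Z` has out-degree exactly `d`, all
      -- of it spent on `B` and `Z`.
      no-slack : total-slack ≡ 0
      no-slack = *-cancelˡ-≡ total-slack 0 2 (+-cancelˡ-≡ (# Z * (2 * # B + # Z)) _ _
        (trans identity (trans (cong (# Z *_) (sym extremal)) (sym (+-identityʳ _)))))

      slack≡0 : ∀ z → Z z ≡ true → slack z ≡ 0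
      slack≡0 z Zz = n≤0⇒n≡0 (begin
        slack z            ≡⟨ sym (*-identityˡ (slack z)) ⟩
        1 * slack z        ≡⟨ cong (λ b → ⟦ b ⟧ * slack z) (sym Zz) ⟩
        ⟦ Z z ⟧ * slack z  ≤⟨ term≤sum (λ z → ⟦ Z z ⟧ * slack z) z ⟩
        total-slack        ≡⟨ no-slack ⟩
        0 ∎)
        where open ≤-Reasoning

      out≡d : ∀ z → Z z ≡ true → out z ≡ d
      out≡d z Zz = ≤-antisym (out≤d z (Z⊆Y z Zz))
        (m∸n≡0⇒m≤n (m+n≡0⇒n≡0 (elsewhere z) (slack≡0 z Zz)))

      out⊆B∪Z : ∀ z v → Z z ≡ true → inY v ≡ true → arc z v ≡ true → B v ≡ false → Z v ≡ true
      out⊆B∪Z z v Zz Yv zv ¬Bv with Z v in Zv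
      ... | true = refl
      ... | false = contradiction
        (#-inhabited (λ v → inY v ∧ (arc z v ∧ (not (B v) ∧ not (Z v))))
          (∧-intro Yv (∧-intro zv (∧-intro (cong not ¬Bv) (cong not Zv)))))
        (<⇒≱ (s≤s (≤-reflexive (m+n≡0⇒m≡0 (elsewhere z) (slack≡0 z Zz)))))

-- An oriented split graph without Sullivan vertices.

module Counterexample (d : ℕ) (arc : Digraph n) (inY : Fin n → Bool)
  (split : IsOrientedSplit arc inY)
  (#Y : # inY ≡ 2 * d)
  (almostRegular : IsAlmostRegularOn arc inY)
  (noSullivan : ∀ u → count (secondOutNbr arc u) < count (inNbr arc u))
  where

  irrefl : ∀ u → arc u u ≡ false
  irrefl = proj₁ (proj₁ split)

  asym : ∀ u v → arc u v ≡ true → arc v u ≡ false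
  asym = proj₂ (proj₁ split)

  independent : ∀ u v → inY u ≡ false → inY v ≡ false → arc u v ≡ false
  independent = proj₁ (proj₂ split)

  semicomplete : ∀ u v → inY u ≡ true → inY v ≡ true → ¬ u ≡ v → arc u v ≡ true ⊎ arc v u ≡ true
  semicomplete = proj₂ (proj₂ split)

  inX : Fin n → Bool
  inX = not ∘ inY

  opaque
    reach : Fin n → Fin n → Bool
    reach u v = any (λ w → arc u w ∧ arc w v) (allFin n)

    reach-via : ∀ {u v} w → arc u w ≡ true → arc w v ≡ true → reach u v ≡ true
    reach-via {u} {v} w uw wv = Equivalence.to T-≡
      (any⁺ (λ w → arc u w ∧ arc w v) (lose (∈-allFin w) (Equivalence.from T-≡ (∧-intro uw wv))))

  second : Fin n → Fin n → Bool
  second u v = reach u v ∧ not (arc u v)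

  opaque
    unfolding reach

    noSullivan# : ∀ u → # (second u) < # (inNbr arc u)
    noSullivan# u = subst₂ _<_ (count≡# (secondOutNbr arc u)) (count≡# (inNbr arc u)) (noSullivan u)

  -- An arc from `b` to `v` would complete a 2-path from `u`, so the tournament orients this pair
  -- the other way.
  arc-of-no-path : ∀ {u b v} → inY b ≡ true → inY v ≡ true → ¬ b ≡ v →
    arc u b ≡ true → reach u v ≡ false → arc v b ≡ true
  arc-of-no-path {b = b} {v} Yb Yv b≢v ub ¬uv with semicomplete b v Yb Yv b≢v
  ... | inj₁ bv = ⊥-elim (true≢false (reach-via b ub bv) ¬uv)
  ... | inj₂ vb = vb

  module Fwd = Tournament arc inY irrefl asym semicomplete
  -- Reversing all arcs turns the domination bound into one on arcs entering a set.
  module Bwd = Tournament (flip arc) inY irrefl (flip asym) (λ u v yu yv u≢v → swap (semicomplete u v yu yv u≢v))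
  open Fwd using (out; in′; degree-sum; arcs-within; arcs-within-flip)

  -- Degrees in the almost regular tournament.

  plus : Fin n → Bool
  plus y = inY y ∧ does (in′ y <? out y)

  -- The two degrees add up to `2 * d - 1` and differ by one; `plus` marks out-degree `d`.
  degrees : ∀ y → inY y ≡ true →
    (plus y ≡ true × out y ≡ d × in′ y + 1 ≡ d) ⊎ (plus y ≡ false × out y + 1 ≡ d × in′ y ≡ d)
  degrees y Yy with subst₂ (λ o i → o ≡ suc i ⊎ i ≡ suc o)
                      (count≡# (λ v → inY v ∧ arc y v)) (count≡# (λ v → inY v ∧ arc v y)) (almostRegular y Yy)
  ... | inj₁ o≡1+i = inj₁
    ( ∧-intro Yy (dec-true (in′ y <? out y) (≤-reflexive (sym o≡1+i)))
    , trans o≡1+i (trans (sym (+-comm (in′ y) 1)) i+1≡d) , i+1≡d)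
    where
    i+1≡d : in′ y + 1 ≡ d
    i+1≡d = *-cancelˡ-≡ (in′ y + 1) d 2 (trans (twice (in′ y))
      (trans (cong (_+ (in′ y + 1)) (sym o≡1+i)) (trans (sym (degree-sum y Yy)) #Y)))
      where
      twice : ∀ i → 2 * (i + 1) ≡ suc i + (i + 1)
      twice = solve-∀
  ... | inj₂ i≡1+o = inj₂
    ( trans (cong (inY y ∧_) (dec-false (in′ y <? out y) (<-asym (≤-reflexive (sym i≡1+o))))) (∧-zeroʳ (inY y))
    , trans (+-comm (out y) 1) (trans (sym i≡1+o) i≡d) , i≡d)
    where
    i≡d : in′ y ≡ d
    i≡d = *-cancelˡ-≡ (in′ y) d 2 (trans (cong (2 *_) i≡1+o) (trans (twice (out y))
      (trans (cong (λ k → out y + (k + 1)) (sym i≡1+o)) (trans (sym (degree-sum y Yy)) #Y))))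
      where
      twice : ∀ o → 2 * suc o ≡ o + (suc o + 1)
      twice = solve-∀

  out≤d : ∀ y → inY y ≡ true → out y ≤ d
  out≤d y Yy with degrees y Yy
  ... | inj₁ (_ , o≡d , _) = ≤-reflexive o≡d
  ... | inj₂ (_ , o+1≡d , _) = ≤-trans (m≤m+n _ 1) (≤-reflexive o+1≡d)

  in≤d : ∀ y → inY y ≡ true → in′ y ≤ d
  in≤d y Yy with degrees y Yy
  ... | inj₁ (_ , _ , i+1≡d) = ≤-trans (m≤m+n _ 1) (≤-reflexive i+1≡d)
  ... | inj₂ (_ , _ , i≡d) = ≤-reflexive i≡d

  out≡d⇒plus : ∀ y → inY y ≡ true → out y ≡ d → plus y ≡ true
  out≡d⇒plus y Yy o≡d with degrees y Yy
  ... | inj₁ (p , _) = p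
  ... | inj₂ (_ , o+1≡d , _) = contradiction (trans (+-comm 1 (out y)) (trans o+1≡d (sym o≡d))) 1+n≢n

  out≡d⇒in≢d : ∀ y → inY y ≡ true → out y ≡ d → ¬ in′ y ≡ d
  out≡d⇒in≢d y Yy o≡d i≡d with degrees y Yy
  ... | inj₁ (_ , _ , i+1≡d) = contradiction (trans (+-comm 1 (in′ y)) (trans i+1≡d (sym i≡d))) 1+n≢n
  ... | inj₂ (_ , o+1≡d , _) = contradiction (trans (+-comm 1 (out y)) (trans o+1≡d (sym o≡d))) 1+n≢n

  -- In-degrees and out-degrees have the same sum over Y, so out-degree `d` and in-degree `d` occur
  -- equally often.
  #plus≡d : # plus ≡ d
  #plus≡d = *-cancelˡ-≡ (# plus) d 2 (+-cancelˡ-≡ (arcs-within inY) _ _ (begin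
    arcs-within inY + 2 * # plus          ≡⟨ double (arcs-within inY) (# plus) ⟩
    (arcs-within inY + # plus) + # plus   ≡⟨ cong (_+ # plus) (sym in-total) ⟩
    # inY * d + # plus                    ≡⟨ out-total ⟩
    arcs-within inY + # inY               ≡⟨ cong (arcs-within inY +_) #Y ⟩
    arcs-within inY + 2 * d               ∎))
    where
    open ≡-Reasoning
    double : ∀ a p → a + 2 * p ≡ (a + p) + p
    double = solve-∀
    in-total : # inY * d ≡ arcs-within inY + # plus
    in-total = begin
      # inY * d                      ≡⟨ *-distribʳ-sum d (λ y → ⟦ inY y ⟧) ⟩
      sum (λ y → ⟦ inY y ⟧ * d)      ≡⟨ sum-split pointwise ⟩
      sum (λ y → ⟦ inY y ⟧ * in′ y) + # plus ≡⟨ cong (_+ # plus) (arcs-within-flip inY) ⟩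
      arcs-within inY + # plus ∎
      where
      pointwise : ∀ y → ⟦ inY y ⟧ * d ≡ ⟦ inY y ⟧ * in′ y + ⟦ plus y ⟧
      pointwise y with inY y in Yy
      ... | false = refl
      ... | true with degrees y Yy
      ...   | inj₁ (p , _ , i+1≡d) rewrite Yy | p = trans (cong (1 *_) (sym i+1≡d)) (*-distribˡ-+ 1 (in′ y) 1)
      ...   | inj₂ (p , _ , i≡d) rewrite Yy | p = trans (cong (1 *_) (sym i≡d)) (sym (+-identityʳ _))
    out-total : # inY * d + # plus ≡ arcs-within inY + # inY
    out-total = begin
      # inY * d + # plus ≡⟨ cong (_+ # plus) (*-distribʳ-sum d (λ y → ⟦ inY y ⟧)) ⟩
      sum (λ y → ⟦ inY y ⟧ * d) + # plus ≡⟨ sym (∑-distrib-+ (λ y → ⟦ inY y ⟧ * d) (λ y → ⟦ plus y ⟧)) ⟩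
      sum (λ y → ⟦ inY y ⟧ * d + ⟦ plus y ⟧) ≡⟨ sum-split pointwise ⟩
      arcs-within inY + # inY ∎
      where
      pointwise : ∀ y → ⟦ inY y ⟧ * d + ⟦ plus y ⟧ ≡ ⟦ inY y ⟧ * out y + ⟦ inY y ⟧
      pointwise y with inY y in Yy
      ... | false = refl
      ... | true with degrees y Yy
      ...   | inj₁ (p , o≡d , _) rewrite Yy | p = cong (λ k → 1 * k + 1) (sym o≡d)
      ...   | inj₂ (p , o+1≡d , _) rewrite Yy | p =
              trans (+-identityʳ _) (trans (cong (1 *_) (sym o+1≡d)) (*-distribˡ-+ 1 (out y) 1))

  -- Inequalities at a vertex of X, and tight vertices.

  -- For x ∈ X, the sets A, B, C, Z, W of the introduction, S = N⁺⁺(x) ∩ X and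
  -- T = {y ∈ Y : x ∈ N⁺⁺(y)}; P is the set of tight vertices.
  A B C Z W S T : Fin n → Fin n → Bool
  A x v = inY v ∧ arc v x
  B x v = inY v ∧ arc x v
  C x v = inY v ∧ (not (arc v x) ∧ not (arc x v))
  Z x v = inY v ∧ (not (arc x v) ∧ not (reach x v))
  W x v = inY v ∧ (not (arc v x) ∧ not (reach v x))
  S x v = inX v ∧ reach x v
  T x v = inY v ∧ second v x

  P : Fin n → Bool
  P x = inX x ∧ does (# (C x) <? # (W x))

  module _ (x : Fin n) (Xx : inY x ≡ false) where

    order : 2 * d ≡ # (A x) + (# (B x) + # (C x))
    order = trans (sym #Y) (sum-split₃ (λ v → cases (inY v) (arc v x) (arc x v) (asym v x)))
      where
      cases : ∀ y a b → (a ≡ true → b ≡ false) →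
        ⟦ y ⟧ ≡ ⟦ y ∧ a ⟧ + (⟦ y ∧ b ⟧ + ⟦ y ∧ (not a ∧ not b) ⟧)
      cases false a b _ = refl
      cases true true b a⇒¬b rewrite a⇒¬b refl = refl
      cases true false true _ = refl
      cases true false false _ = refl

    -- As X is independent, all in-neighbours of `x` are in `A x`. Each vertex of `A x` or `C x`
    -- lies in exactly one of `second x` and `Z x`; the part of `second x` in X is `S x`.
    second-split : # (second x) + # (Z x) ≡ # (inNbr arc x) + (# (C x) + # (S x))
    second-split = begin
      # (second x) + # (Z x)
        ≡⟨ sym (∑-distrib-+ (λ v → ⟦ second x v ⟧) (λ v → ⟦ Z x v ⟧)) ⟩
      sum (λ v → ⟦ second x v ⟧ + ⟦ Z x v ⟧)
        ≡⟨ sum-split₃ (λ v → cases (inY v) (arc v x) (arc x v) (reach x v) (asym v x)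
             (λ Xv → independent v x Xv Xx) (independent x v Xx)) ⟩
      # (inNbr arc x) + (# (C x) + # (S x)) ∎
      where
      open ≡-Reasoning
      cases : ∀ y a b r → (a ≡ true → b ≡ false) → (y ≡ false → a ≡ false) → (y ≡ false → b ≡ false) →
        ⟦ r ∧ not b ⟧ + ⟦ y ∧ (not b ∧ not r) ⟧ ≡ ⟦ a ⟧ + (⟦ y ∧ (not a ∧ not b) ⟧ + ⟦ not y ∧ r ⟧)
      cases false a b r _ ¬a ¬b rewrite ¬a refl | ¬b refl with r
      ... | true = refl
      ... | false = refl
      cases true true b r a⇒¬b _ _ rewrite a⇒¬b refl with r
      ... | true = refl
      ... | false = refl
      cases true false true true _ _ _ = refl
      cases true false true false _ _ _ = refl
      cases true false false true _ _ _ = refl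
      cases true false false false _ _ _ = refl

    C+S<Z : # (C x) + # (S x) < # (Z x)
    C+S<Z = +-cancelˡ-< (# (inNbr arc x)) _ _
      (subst (_< # (inNbr arc x) + # (Z x)) second-split (+-monoˡ-< (# (Z x)) (noSullivan# x)))

    -- The vertices of Y outside `A x` form `B x` and `C x`; they also split into `T x` and `W x`,
    -- according to whether a 2-path leads to `x`.
    T+W≡B+C : # (T x) + # (W x) ≡ # (B x) + # (C x)
    T+W≡B+C = begin
      # (T x) + # (W x) ≡⟨ sym (∑-distrib-+ (λ v → ⟦ T x v ⟧) (λ v → ⟦ W x v ⟧)) ⟩
      sum (λ v → ⟦ T x v ⟧ + ⟦ W x v ⟧)
        ≡⟨ sum-split (λ v → cases (inY v) (arc v x) (arc x v) (reach v x) (asym v x)) ⟩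
      # (B x) + # (C x) ∎
      where
      open ≡-Reasoning
      cases : ∀ y a b r → (a ≡ true → b ≡ false) →
        ⟦ y ∧ (r ∧ not a) ⟧ + ⟦ y ∧ (not a ∧ not r) ⟧ ≡ ⟦ y ∧ b ⟧ + ⟦ y ∧ (not a ∧ not b) ⟧
      cases false a b r _ = refl
      cases true true b r a⇒¬b rewrite a⇒¬b refl with r
      ... | true = refl
      ... | false = refl
      cases true false true true _ = refl
      cases true false true false _ = refl
      cases true false false true _ = refl
      cases true false false false _ = refl

    -- `Z` is coded by the absence of 2-paths from `x`; in a tournament this amounts to dominating
    -- `B`.
    Z⇒B : ∀ z b → Z x z ≡ true → B x b ≡ true → arc z b ≡ true
    Z⇒B z b Zz Bb =
      let Yz , Zz′ = ∧-true Zz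
          ¬xz , ¬reach = ∧-true Zz′
          Yb , xb = ∧-true Bb
      in arc-of-no-path Yb Yz (λ { refl → true≢false xb (not-true ¬xz) }) xb (not-true ¬reach)

    A⇒W : ∀ w a → W x w ≡ true → A x a ≡ true → arc a w ≡ true
    A⇒W w a Ww Aa with ∧-true {inY w} Ww | ∧-true {inY a} Aa
    ... | Yw , Ww′ | Ya , ax with ∧-true {not (arc w x)} Ww′
    ...   | ¬wx , ¬reach with semicomplete w a Yw Ya (λ { refl → true≢false ax (not-true ¬wx) })
    ...     | inj₁ wa = ⊥-elim (true≢false (reach-via a wa ax) (not-true ¬reach))
    ...     | inj₂ aw = aw

    module Out = Fwd.Domination d out≤d (Z x) (B x)
      (λ _ → proj₁ ∘ ∧-true) (λ _ → proj₁ ∘ ∧-true) Z⇒B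
    -- In the reversed tournament `W` takes the place of `Z`, and `A` that of `B`.
    module In = Bwd.Domination d in≤d (W x) (A x)
      (λ _ → proj₁ ∘ ∧-true) (λ _ → proj₁ ∘ ∧-true) A⇒W

    1≤Z : 1 ≤ # (Z x)
    1≤Z = ≤-trans (s≤s z≤n) C+S<Z

    module _ (1≤W : 1 ≤ # (W x)) where

      Z+W≤2C+2 : # (Z x) + # (W x) ≤ suc (# (C x)) + suc (# (C x))
      Z+W≤2C+2 = +-cancelˡ-≤ (2 * (# (A x) + # (B x))) _ _ (begin
        2 * (# (A x) + # (B x)) + (# (Z x) + # (W x))
          ≡⟨ left (# (A x)) (# (B x)) (# (Z x)) (# (W x)) ⟩
        (2 * # (B x) + # (Z x)) + (2 * # (A x) + # (W x))
          ≤⟨ +-mono-≤ (Out.bound 1≤Z) (In.bound 1≤W) ⟩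
        (2 * d + 1) + (2 * d + 1)
          ≡⟨ cong (λ k → (k + 1) + (k + 1)) order ⟩
        (# (A x) + (# (B x) + # (C x)) + 1) + (# (A x) + (# (B x) + # (C x)) + 1)
          ≡⟨ right (# (A x)) (# (B x)) (# (C x)) ⟩
        2 * (# (A x) + # (B x)) + (suc (# (C x)) + suc (# (C x))) ∎)
        where
        open ≤-Reasoning
        left : ∀ a b z w → 2 * (a + b) + (z + w) ≡ (2 * b + z) + (2 * a + w)
        left = solve-∀
        right : ∀ a b c → (a + (b + c) + 1) + (a + (b + c) + 1) ≡ 2 * (a + b) + (suc c + suc c)
        right = solve-∀

      -- `C+S<Z` makes `Z` use up at least half of the joint bound.
      W≤1+C : # (W x) ≤ suc (# (C x))
      W≤1+C = +-cancelˡ-≤ (suc (# (C x))) _ _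
        (≤-trans (+-monoˡ-≤ (# (W x)) (≤-trans (s≤s (m≤m+n _ _)) C+S<Z)) Z+W≤2C+2)

    -- By `T+W≡B+C` the excess of `B` over `T` equals that of `W` over `C`. It is at most 1, and
    -- positive only if `x` is tight.
    B≤T+P : # (B x) ≤ # (T x) + ⟦ P x ⟧
    B≤T+P = +-cancelʳ-≤ (# (C x)) _ _ (begin
      # (B x) + # (C x)              ≡⟨ sym T+W≡B+C ⟩
      # (T x) + # (W x)              ≤⟨ +-monoʳ-≤ (# (T x)) W≤P+C ⟩
      # (T x) + (⟦ P x ⟧ + # (C x))  ≡⟨ sym (+-assoc (# (T x)) _ _) ⟩
      # (T x) + ⟦ P x ⟧ + # (C x)    ∎)
      where
      open ≤-Reasoning
      W≤P+C : # (W x) ≤ ⟦ P x ⟧ + # (C x)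
      W≤P+C with <-≤-connex (# (C x)) (# (W x))
      ... | inj₁ C<W = subst (λ b → # (W x) ≤ ⟦ b ⟧ + # (C x))
              (sym (∧-intro (cong not Xx) (dec-true (# (C x) <? # (W x)) C<W)))
              (W≤1+C (≤-trans (s≤s z≤n) C<W))
      ... | inj₂ W≤C = ≤-trans W≤C (m≤n+m (# (C x)) ⟦ P x ⟧)

    module Tight (C<W : # (C x) < # (W x)) where

      1≤W : 1 ≤ # (W x)
      1≤W = ≤-trans (s≤s z≤n) C<W

      #W : # (W x) ≡ suc (# (C x))
      #W = ≤-antisym (W≤1+C 1≤W) C<W

      Z≤1+C : # (Z x) ≤ suc (# (C x))
      Z≤1+C = +-cancelʳ-≤ (suc (# (C x))) _ _
        (≤-trans (+-monoʳ-≤ (# (Z x)) C<W) (Z+W≤2C+2 1≤W))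

      #Z : # (Z x) ≡ suc (# (C x))
      #Z = ≤-antisym Z≤1+C (≤-trans (s≤s (m≤m+n _ _)) C+S<Z)

      #S : # (S x) ≡ 0
      #S = n≤0⇒n≡0 (+-cancelˡ-≤ (# (C x)) _ _
        (≤-trans (s≤s⁻¹ (≤-trans C+S<Z Z≤1+C)) (≤-reflexive (sym (+-identityʳ _)))))

      -- The sizes of `Z` and `W` turn the sum of the two domination bounds into an equality, so
      -- neither bound can be strict.
      balance : (2 * # (B x) + # (Z x)) + (2 * # (A x) + # (W x)) ≡ (2 * d + 1) + (2 * d + 1)
      balance = begin
        (2 * # (B x) + # (Z x)) + (2 * # (A x) + # (W x))
          ≡⟨ cong₂ (λ z w → (2 * # (B x) + z) + (2 * # (A x) + w)) #Z #W ⟩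
        (2 * # (B x) + suc (# (C x))) + (2 * # (A x) + suc (# (C x)))
          ≡⟨ collect (# (A x)) (# (B x)) (# (C x)) ⟩
        (# (A x) + (# (B x) + # (C x)) + 1) + (# (A x) + (# (B x) + # (C x)) + 1)
          ≡⟨ cong (λ k → (k + 1) + (k + 1)) (sym order) ⟩
        (2 * d + 1) + (2 * d + 1) ∎
        where
        open ≡-Reasoning
        collect : ∀ a b c → (2 * b + suc c) + (2 * a + suc c) ≡ (a + (b + c) + 1) + (a + (b + c) + 1)
        collect = solve-∀

      extremalZ : 2 * # (B x) + # (Z x) ≡ 2 * d + 1
      extremalZ = ≤-antisym (Out.bound 1≤Z) (+-cancelʳ-≤ (2 * d + 1) _ _
        (≤-trans (≤-reflexive (sym balance)) (+-monoʳ-≤ (2 * # (B x) + # (Z x)) (In.bound 1≤W))))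

      extremalW : 2 * # (A x) + # (W x) ≡ 2 * d + 1
      extremalW = +-cancelˡ-≡ (2 * d + 1) _ _
        (trans (cong (_+ (2 * # (A x) + # (W x))) (sym extremalZ)) balance)

      open Out.Extremal extremalZ public using () renaming (out≡d to Z-out≡d; out⊆B∪Z to Z-out⊆B∪Z)
      open In.Extremal extremalW public using () renaming (out≡d to W-in≡d; out⊆B∪Z to W-in⊆A∪W)

      no-2-path-to-X : ∀ {v} w → inY v ≡ false → arc x w ≡ true → arc w v ≡ true → ⊥
      no-2-path-to-X w Xv xw wv = contradiction
        (#-inhabited (S x) (∧-intro (cong not Xv) (reach-via w xw wv)))
        (<⇒≱ (s≤s (≤-reflexive #S)))

      -- `Z` has one vertex more than `C`, so it has a vertex outside `C`; `Z` avoids `B`, which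
      -- leaves `A`.
      Z∩A : ∃ λ z → Z x z ≡ true × A x z ≡ true
      Z∩A = let z , Zz , ¬Cz = #<#⇒∃ (Z x) (C x) (≤-reflexive (sym #Z))
                Yz , Zz′ = ∧-true {inY z} Zz
            in z , Zz , ∧-intro Yz (¬-not (λ ¬zx → true≢false
                 (∧-intro Yz (∧-intro (cong not ¬zx) (proj₁ (∧-true {not (arc x z)} Zz′)))) ¬Cz))

      -- A vertex of W ∩ C is dominated by Z ∩ A, so it lies in Z; but vertices of Z have
      -- out-degree d and those of W in-degree d.
      W∩C-empty : ∀ w → W x w ≡ true → C x w ≡ true → ⊥
      W∩C-empty w Ww Cw =
        let z , Zz , Az = Z∩A
            Yw , Cw′ = ∧-true {inY w} Cw
            ¬Bw = trans (cong (inY w ∧_) (not-true (proj₂ (∧-true {not (arc w x)} Cw′)))) (∧-zeroʳ (inY w))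
            Zw = Z-out⊆B∪Z z w Zz Yw (A⇒W w z Ww Az) ¬Bw
        in out≡d⇒in≢d w Yw (Z-out≡d w Zw) (W-in≡d w Ww)

      W⊆B : ∀ w → W x w ≡ true → arc x w ≡ true
      W⊆B w Ww = ¬-not (λ ¬xw →
        let Yw , Ww′ = ∧-true {inY w} Ww
        in W∩C-empty w Ww (∧-intro Yw (∧-intro (proj₁ (∧-true {not (arc w x)} Ww′)) (cong not ¬xw))))

  P⇒X : ∀ {x} → P x ≡ true → inY x ≡ false
  P⇒X = not-true ∘ proj₁ ∘ ∧-true

  P⇒C<W : ∀ {x} → P x ≡ true → # (C x) < # (W x)
  P⇒C<W {x} Px with <-≤-connex (# (C x)) (# (W x))
  ... | inj₁ C<W = C<W
  ... | inj₂ W≤C = ⊥-elim (true≢false (proj₂ (∧-true {inX x} Px)) (dec-false (# (C x) <? # (W x)) (≤⇒≯ W≤C)))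

  -- Inequalities at a vertex of Y.

  module _ (y : Fin n) (Yy : inY y ≡ true) where

    N⁺[y] : Fin n → Bool
    N⁺[y] v = inY v ∧ (arc y v ∨ does (y ≟ v))

    missed : Fin n → Bool
    missed v = inY v ∧ (arc v y ∧ not (reach y v))

    #N⁺[y] : # N⁺[y] ≡ out y + 1
    #N⁺[y] = trans (sum-split pointwise) (cong (out y +_) (#-singleton y))
      where
      pointwise : ∀ v → ⟦ N⁺[y] v ⟧ ≡ ⟦ inY v ∧ arc y v ⟧ + ⟦ does (y ≟ v) ⟧
      pointwise v with y ≟ v
      ... | yes refl rewrite Yy | irrefl y = refl
      ... | no _ rewrite ∨-identityʳ (arc y v) = sym (+-identityʳ _)

    -- The closed neighbourhood also contains `y`, dominated because `v` is an in-neighbour; this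
    -- extra vertex sharpens the domination bound by 2.
    missed⇒N⁺[y] : ∀ v b → missed v ≡ true → N⁺[y] b ≡ true → arc v b ≡ true
    missed⇒N⁺[y] v b Mv Nb with ∧-true {inY v} Mv | ∧-true {inY b} Nb
    ... | Yv , Mv′ | Yb , Nb′ with ∧-true {arc v y} Mv′ | y ≟ b
    ...   | vy , _ | yes refl = vy
    ...   | vy , ¬reach | no _ = arc-of-no-path Yb Yv (λ { refl → true≢false yb (asym v y vy) }) yb (not-true ¬reach)
      where
      yb : arc y b ≡ true
      yb = trans (sym (∨-identityʳ (arc y b))) Nb′

    -- An in-neighbour v of y with no 2-path from y has out-degree at least out y + 1, so by
    -- domination there is at most one such v, and none if out y is already d.
    missed+plus≤1 : # missed + ⟦ plus y ⟧ ≤ 1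
    missed+plus≤1 with n≡0⊎1≤n (# missed)
      where
      n≡0⊎1≤n : ∀ m → m ≡ 0 ⊎ 1 ≤ m
      n≡0⊎1≤n zero = inj₁ refl
      n≡0⊎1≤n (suc m) = inj₂ (s≤s z≤n)
    ... | inj₁ M≡0 rewrite M≡0 = ⟦⟧≤1 (plus y)
      where
      ⟦⟧≤1 : ∀ b → ⟦ b ⟧ ≤ 1
      ⟦⟧≤1 true = ≤-refl
      ⟦⟧≤1 false = z≤n
    ... | inj₂ 1≤M with degrees y Yy
    ...   | inj₁ (_ , o≡d , _) = ⊥-elim (m+n≮m (2 * d + 1) (# missed) (begin-strict
            2 * d + 1 + # missed      <⟨ n<1+n _ ⟩
            suc (2 * d + 1 + # missed) ≡⟨ shift d (# missed) ⟩
            2 * (d + 1) + # missed    ≡⟨ cong (λ k → 2 * (k + 1) + # missed) (sym o≡d) ⟩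
            2 * (out y + 1) + # missed ≡⟨ cong (λ k → 2 * k + # missed) (sym #N⁺[y]) ⟩
            2 * # N⁺[y] + # missed    ≤⟨ Fwd.Domination.bound d out≤d missed N⁺[y]
                                            (λ _ → proj₁ ∘ ∧-true) (λ _ → proj₁ ∘ ∧-true) missed⇒N⁺[y] 1≤M ⟩
            2 * d + 1 ∎))
      where
      open ≤-Reasoning
      shift : ∀ d m → suc (2 * d + 1 + m) ≡ 2 * (d + 1) + m
      shift = solve-∀
    ...   | inj₂ (p , o+1≡d , _) rewrite p = +-cancelˡ-≤ (2 * d) _ _ (begin
            2 * d + (# missed + 0)    ≡⟨ cong₂ (λ k m → 2 * k + m) (trans (sym o+1≡d) (sym #N⁺[y])) (+-identityʳ _) ⟩
            2 * # N⁺[y] + # missed    ≤⟨ Fwd.Domination.bound d out≤d missed N⁺[y]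
                                            (λ _ → proj₁ ∘ ∧-true) (λ _ → proj₁ ∘ ∧-true) missed⇒N⁺[y] 1≤M ⟩
            2 * d + 1 ∎)
      where open ≤-Reasoning

    X-in X-second : ℕ
    X-in = # (λ x → inX x ∧ arc x y)
    X-second = # (λ x → inX x ∧ second y x)

    in-split : # (inNbr arc y) ≡ in′ y + X-in
    in-split = sum-split (λ v → cases (inY v) (arc v y))
      where
      cases : ∀ b a → ⟦ a ⟧ ≡ ⟦ b ∧ a ⟧ + ⟦ not b ∧ a ⟧
      cases true a = sym (+-identityʳ _)
      cases false a = refl

    -- An in-neighbour of `y` in Y is in `second y` or in `missed`; `X-second` counts only X, so
    -- nothing is counted twice.
    second-bound : in′ y + X-second ≤ # (second y) + # missed
    second-bound = begin
      in′ y + X-second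
        ≡⟨ sym (∑-distrib-+ (λ v → ⟦ inY v ∧ arc v y ⟧) (λ v → ⟦ inX v ∧ second y v ⟧)) ⟩
      sum (λ v → ⟦ inY v ∧ arc v y ⟧ + ⟦ inX v ∧ second y v ⟧)
        ≤⟨ sum-mono (λ v → cases (inY v) (arc v y) (reach y v) (arc y v) (asym v y)) ⟩
      sum (λ v → ⟦ second y v ⟧ + ⟦ missed v ⟧)
        ≡⟨ ∑-distrib-+ (λ v → ⟦ second y v ⟧) (λ v → ⟦ missed v ⟧) ⟩
      # (second y) + # missed ∎
      where
      open ≤-Reasoning
      cases : ∀ b a r o → (a ≡ true → o ≡ false) →
        ⟦ b ∧ a ⟧ + ⟦ not b ∧ (r ∧ not o) ⟧ ≤ ⟦ r ∧ not o ⟧ + ⟦ b ∧ (a ∧ not r) ⟧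
      cases false a r o _ = ≤-reflexive (sym (+-identityʳ _))
      cases true false r o _ = z≤n
      cases true true true o a⇒¬o rewrite a⇒¬o refl = ≤-refl
      cases true true false o _ = ≤-refl

    -- The Sullivan inequality fails at `y` by at least 1. A missed vertex can use up this surplus
    -- only when `plus y` is false.
    X-second+plus≤X-in : X-second + ⟦ plus y ⟧ ≤ X-in
    X-second+plus≤X-in = +-cancelˡ-≤ (in′ y + # missed) _ _ (begin
      (in′ y + # missed) + (X-second + ⟦ plus y ⟧) ≡⟨ exchange (in′ y) (# missed) X-second ⟦ plus y ⟧ ⟩
      (in′ y + X-second) + (# missed + ⟦ plus y ⟧) ≤⟨ +-mono-≤ second-bound missed+plus≤1 ⟩
      (# (second y) + # missed) + 1              ≡⟨ increment (# (second y)) (# missed) ⟩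
      suc (# (second y)) + # missed              ≤⟨ +-monoˡ-≤ (# missed) (noSullivan# y) ⟩
      # (inNbr arc y) + # missed                 ≡⟨ cong (_+ # missed) in-split ⟩
      (in′ y + X-in) + # missed                  ≡⟨ exchange′ (in′ y) X-in (# missed) ⟩
      (in′ y + # missed) + X-in ∎)
      where
      open ≤-Reasoning
      exchange : ∀ i m s p → (i + m) + (s + p) ≡ (i + s) + (m + p)
      exchange = solve-∀
      exchange′ : ∀ i x m → (i + x) + m ≡ (i + m) + x
      exchange′ = solve-∀
      increment : ∀ s m → (s + m) + 1 ≡ suc s + m
      increment = solve-∀

  -- Double counting of the tight vertices.

  d≤#P : d ≤ # P
  d≤#P = +-cancelˡ-≤ (sum (λ x → ⟦ inX x ⟧ * # (T x))) _ _ (begin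
    sum (λ x → ⟦ inX x ⟧ * # (T x)) + d
      ≡⟨ cong₂ _+_ (sym (double-count inY inX (λ x y → second y x))) (sym #plus≡d) ⟩
    sum (λ y → ⟦ inY y ⟧ * # (λ x → inX x ∧ second y x)) + # plus
      ≡⟨ sym (∑-distrib-+ (λ y → ⟦ inY y ⟧ * # (λ x → inX x ∧ second y x)) (λ y → ⟦ plus y ⟧)) ⟩
    sum (λ y → ⟦ inY y ⟧ * # (λ x → inX x ∧ second y x) + ⟦ plus y ⟧)
      -- The surpluses of the vertices in `plus` add up to `d`.
      ≤⟨ sum-mono from-Y ⟩
    sum (λ y → ⟦ inY y ⟧ * # (λ x → inX x ∧ arc x y))
      ≡⟨ double-count inY inX arc ⟩
    sum (λ x → ⟦ inX x ⟧ * # (B x))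
      -- Each vertex of X absorbs at most 1 of this surplus, and only if it is tight.
      ≤⟨ sum-mono from-X ⟩
    sum (λ x → ⟦ inX x ⟧ * # (T x) + ⟦ P x ⟧)
      ≡⟨ ∑-distrib-+ (λ x → ⟦ inX x ⟧ * # (T x)) (λ x → ⟦ P x ⟧) ⟩
    sum (λ x → ⟦ inX x ⟧ * # (T x)) + # P ∎)
    where
    open ≤-Reasoning
    from-Y : ∀ y → ⟦ inY y ⟧ * # (λ x → inX x ∧ second y x) + ⟦ plus y ⟧ ≤ ⟦ inY y ⟧ * # (λ x → inX x ∧ arc x y)
    from-Y y = cases (inY y) refl
      where
      cases : ∀ b → inY y ≡ b → ⟦ b ⟧ * # (λ x → inX x ∧ second y x) + ⟦ plus y ⟧ ≤ ⟦ b ⟧ * # (λ x → inX x ∧ arc x y)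
      cases false ¬Yy rewrite ¬Yy = z≤n
      cases true Yy = subst₂ (λ s i → s + ⟦ plus y ⟧ ≤ i) (sym (*-identityˡ _)) (sym (*-identityˡ _)) (X-second+plus≤X-in y Yy)
    from-X : ∀ x → ⟦ inX x ⟧ * # (B x) ≤ ⟦ inX x ⟧ * # (T x) + ⟦ P x ⟧
    from-X x = cases (inY x) refl
      where
      cases : ∀ b → inY x ≡ b → ⟦ not b ⟧ * # (B x) ≤ ⟦ not b ⟧ * # (T x) + ⟦ P x ⟧
      cases true _ = z≤n
      cases false Xx = subst₂ (λ b t → b ≤ t + ⟦ P x ⟧) (sym (*-identityˡ _)) (sym (*-identityˡ _)) (B≤T+P x Xx)

  -- Descent among tight vertices.

  C-decreases : ∀ {t t′} (Pt : P t ≡ true) (Pt′ : P t′ ≡ true) z →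
    Z t z ≡ true → A t z ≡ true → C t′ z ≡ true → # (C t′) < # (C t)
  C-decreases {t} {t′} Pt Pt′ z Zz Az Cz =
    ≤-trans (≤-reflexive (sym t′.#W)) (#-mono W⊆C)
    where
    module t = Tight t (P⇒X Pt) (P⇒C<W Pt)
    module t′ = Tight t′ (P⇒X Pt′) (P⇒C<W Pt′)
    Yz : inY z ≡ true
    Yz = proj₁ (∧-true {inY z} Az)
    ¬zt′ : arc z t′ ≡ false
    ¬zt′ = not-true (proj₁ (∧-true {not (arc z t′)} (proj₂ (∧-true {inY z} Cz))))
    -- An arc from `w` to `t` would end a 2-path from the tight vertex `t′` to X. An arc from `t` to
    -- `w` would put `w` in `B t`, which `z` dominates, whereas `w` dominates `z`.
    W⊆C : ∀ w → W t′ w ≡ true → C t w ≡ true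
    W⊆C w Ww = ∧-intro Yw (∧-intro (cong not (¬-not ¬wt)) (cong not (¬-not ¬tw)))
      where
      Yw : inY w ≡ true
      Yw = proj₁ (∧-true {inY w} Ww)
      t′w : arc t′ w ≡ true
      t′w = t′.W⊆B w Ww
      wz : arc w z ≡ true
      wz with semicomplete w z Yw Yz (λ { refl → t′.W∩C-empty z Ww Cz })
      ... | inj₁ wz = wz
      -- All in-neighbours of `w` in Y lie in `A t′` or `W t′`; `z` is in `C t′`, which meets
      -- neither.
      ... | inj₂ zw = ⊥-elim (t′.W∩C-empty z
              (t′.W-in⊆A∪W w z Ww Yz zw (trans (cong (inY z ∧_) ¬zt′) (∧-zeroʳ (inY z)))) Cz)
      ¬wt : ¬ arc w t ≡ true
      ¬wt wt = t′.no-2-path-to-X w (P⇒X Pt) t′w wt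
      ¬tw : ¬ arc t w ≡ true
      ¬tw tw = true≢false wz (asym z w (Z⇒B t (P⇒X Pt) z w Zz (∧-intro Yw tw)))

  plus⇒in-neighbour : ∀ z → inY z ≡ true → plus z ≡ true → ∃ λ x → inX x ∧ arc x z ≡ true
  plus⇒in-neighbour z Yz z-plus = #-positive (λ x → inX x ∧ arc x z)
    (≤-trans (m≤n+m 1 (X-second z Yz))
      (subst (λ b → X-second z Yz + ⟦ b ⟧ ≤ X-in z Yz) z-plus (X-second+plus≤X-in z Yz)))

  -- The 2-paths through `z` put all of `P` into `S x`, so `Z x` has more than `d` vertices; but
  -- each of them dominates `z`.
  not-above-all-P : ∀ x z → inY x ≡ false → inY z ≡ true → arc x z ≡ true →
    (∀ t → P t ≡ true → arc z t ≡ true) → ⊥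
  not-above-all-P x z Xx Yz xz z→P = <-irrefl refl (begin-strict
      d        ≤⟨ d≤#P ⟩
      # P      ≤⟨ #-mono P⊆S ⟩
      # (S x)  ≤⟨ m≤n+m (# (S x)) (# (C x)) ⟩
      # (C x) + # (S x) <⟨ C+S<Z x Xx ⟩
      # (Z x)  ≤⟨ #-mono Z⊆N⁻ ⟩
      in′ z    ≤⟨ in≤d z Yz ⟩
      d ∎)
    where
    open ≤-Reasoning
    P⊆S : ∀ t → P t ≡ true → S x t ≡ true
    P⊆S t Pt = ∧-intro (cong not (P⇒X Pt)) (reach-via z xz (z→P t Pt))
    Z⊆N⁻ : ∀ v → Z x v ≡ true → inY v ∧ arc v z ≡ true
    Z⊆N⁻ v Zv = ∧-intro (proj₁ (∧-true {inY v} Zv)) (Z⇒B x Xx v z Zv (∧-intro Yz xz))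

  -- Infinite descent on |C| instead of a choice of t with |C| minimal.
  descent : ∀ k t → P t ≡ true → # (C t) < k → ⊥
  descent (suc k) t Pt C<k = step (Tight.Z∩A t (P⇒X Pt) (P⇒C<W Pt))
    where
    module _ (z : Fin n) (Zz : Z t z ≡ true) (Az : A t z ≡ true) where
      Yz : inY z ≡ true
      Yz = proj₁ (∧-true {inY z} Az)
      zt : arc z t ≡ true
      zt = proj₂ (∧-true {inY z} Az)
      z-plus : plus z ≡ true
      z-plus = out≡d⇒plus z Yz (Tight.Z-out≡d t (P⇒X Pt) (P⇒C<W Pt) z Zz)
      -- An arc from `t′` to `z` would continue to `t`, a 2-path into X. So if `z` does not dominate
      -- `t′`, it lies in `C t′`, and `t′` has a smaller `C` than `t`.
      z→P : ∀ t′ → P t′ ≡ true → arc z t′ ≡ true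
      z→P t′ Pt′ = ¬-not (λ ¬zt′ → descent k t′ Pt′ (≤-trans
        (C-decreases Pt Pt′ z Zz Az (∧-intro Yz (∧-intro (cong not ¬zt′) (cong not (¬-not ¬t′z)))))
        (s≤s⁻¹ C<k)))
        where
        ¬t′z : ¬ arc t′ z ≡ true
        ¬t′z t′z = Tight.no-2-path-to-X t′ (P⇒X Pt′) (P⇒C<W Pt′) z (P⇒X Pt) t′z zt
    step : (∃ λ z → Z t z ≡ true × A t z ≡ true) → ⊥
    step (z , Zz , Az) =
      let x , XAx = plus⇒in-neighbour z (Yz z Zz Az) (z-plus z Zz Az)
          Xx , xz = ∧-true {inX x} XAx
      in not-above-all-P x z (not-true Xx) (Yz z Zz Az) xz (z→P z Zz Az)

  absurd : 1 ≤ d → ⊥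
  absurd 1≤d =
    let t , Pt = #-positive P (≤-trans 1≤d d≤#P)
    in descent (suc (# (C t))) t Pt ≤-refl

theorem4p8 : (n d : ℕ) → 1 ≤ d → (arc : Digraph n) → (inY : Fin n → Bool) →
    IsOrientedSplit arc inY →
    count inY ≡ 2 * d →
    IsAlmostRegularOn arc inY →
    ∃ λ (u : Fin n) → IsSullivan arc u
theorem4p8 n d 1≤d arc inY split #Y almostRegular
  with any? (λ u → count (inNbr arc u) ≤? count (secondOutNbr arc u))
... | yes sullivan = sullivan
... | no ¬sullivan = ⊥-elim (Counterexample.absurd d arc inY split (trans (sym (count≡# inY)) #Y) almostRegular
        (λ u → ≰⇒> (λ sullivan → ¬sullivan (u , sullivan))) 1≤d)
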